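{- Let $p\ge 2$ be an integer, $\pi$ a $p$-adic permutation, and $G$ a $p$-adic system. Then there is a $p$-adic system $F$ such that $\pi=\pi_{F,G}$. The $p$-adic system $F$ is uniquely determined up to $\sim_p$.
   Context: $p\ge2$ is an integer, not necessarily prime. $\mathbb{Z}_p=\varprojlim \mathbb{Z}/p^k\mathbb{Z}$; every $a\in\mathbb{Z}_p$ is uniquely $a=\sum_{i\ge0}a_ip^i$ with $a_i\in\{0,\dots,p-1\}$, and $a\,\%\,p:=a_0$. A $p$-fibred function with domain $\mathbb{Z}_p$ is a $p$-tuple $F=(F[0],\dots,F[p-1])$ of functions $F[r]:\mathbb{Z}_p\to\mathbb{Z}_p$, regarded also as a function $F:\mathbb{Z}_p\to\mathbb{Z}_p$ by $F(n)=\dfrac{F[n\%p](n)-(F[n\%p](n)\,\%\,p)}{p}$. The $F$-digit expansion of $n$ is $\psi_F(n):=(F^k(n)\,\%\,p)_{k\ge0}$. $F$ is a $p$-adic system if for all integers $k\ge0$ and all $m,n\in\mathbb{Z}_p$: $m\equiv n\pmod{p^k}$ if and only if the first $k$ entries of $\psi_F(m)$ and $\psi_F(n)$ coincide. For a $p$-adic system $F$, the map $\psi_F$ is a bijection from $\mathbb{Z}_p$ onto the set of infinite sequences with entries in $\{0,\dots,p-1\}$. For $p$-adic systems $F,G$ put $\pi_{F,G}:=\psi_G^{ -1}\circ\psi_F:\mathbb{Z}_p\to\mathbb{Z}_p$. $F\sim_p F'$ means that $F(n)=F'(n)$ for all $n\in\mathbb{Z}_p$ (equality as functions on $\mathbb{Z}_p$).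 A $p$-adic permutation is a permutation $\pi$ of $\mathbb{Z}_p$ such that $\pi(n)\equiv n\pmod p$ for all $n\in\mathbb{Z}_p$, and for all integers $k\ge1$ and all $m,n\in\mathbb{Z}_p$: $m\equiv n\pmod{p^k}\Leftrightarrow\pi(m)\equiv\pi(n)\pmod{p^k}$. -}

module Defs where

open import Data.Nat.Base as ℕ
  using (ℕ; zero; suc; _<_; _^_; _%_; _/_; NonZero; NonTrivial; s≤s)
import Data.Nat.Properties as ℕₚ
open import Data.Nat.Divisibility using (n∣m*n; m∣m*n)
import Data.Nat.DivMod as DM
open import Data.Nat.GeneralisedArithmetic using (iterate)
open import Data.Fin.Base using (Fin; toℕ; fromℕ<; cast; punchOut; funToFin; finToFun)
open import Data.Fin.Properties
  using (toℕ-injective; toℕ-fromℕ<; toℕ-cast; toℕ<n; any?; _≟_; injective⇒≤;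
         punchOut-injective; finToFun-funToFin)
open import Data.Product.Base using (∃; _,_; proj₁; proj₂)
open import Function.Base using (_∘_)
open import Function.Bundles
  using (Func; Bijection; _⇔_; module Equivalence)
open import Function.Definitions using (Injective; StrictlySurjective)
open import Function.Structures using (IsBijection)
open import Level using (0ℓ)
open import Relation.Binary.Bundles using (Setoid)
open import Relation.Binary.PropositionalEquality
  using (_≡_; refl; sym; trans; cong; cong₂; subst; _→-setoid_; module ≡-Reasoning)
open import Relation.Nullary using (yes; no; contradiction)

private
  Fin-injective⇒surjective : ∀ {n} (f : Fin n → Fin n) →
    Injective _≡_ _≡_ f → StrictlySurjective _≡_ f
  Fin-injective⇒surjective {suc n} f inj y with any? (λ x → f x ≟ y)
  ... | yes hit = hit
  ... | no miss = contradiction (injective⇒≤ g-injective) ℕₚ.1+n≰n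
    where
    avoids : ∀ x → y ≡ f x → _
    avoids x eq = miss (x , sym eq)

    g-injective : Injective _≡_ _≡_ (λ x → punchOut (avoids x))
    g-injective {a} {b} eq = inj (punchOut-injective (avoids a) (avoids b) eq)

module PAdic (p : ℕ) .{{p>1 : NonTrivial p}} where

  private
    instance
      p≢0 : NonZero p
      p≢0 = ℕ.nonTrivial⇒nonZero p

  infix  4 _≈_ _≡_mod^_ _∼ₚ_
  infixl 6 _+_
  infixl 7 _*_

  reduce : ℕ → ∀ k → Fin (p ^ k)
  reduce x k = _mod_ x (p ^ k) {{ℕₚ.m^n≢0 p k}}
    where open DM using (_mod_)

  rem : ℕ → ℕ → ℕ
  rem x k = _%_ x (p ^ k) {{ℕₚ.m^n≢0 p k}}

  toℕ-reduce : ∀ x k → toℕ (reduce x k) ≡ rem x k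
  toℕ-reduce x k = toℕ-fromℕ< _

  rem-small : ∀ {x} k → x < p ^ k → rem x k ≡ x
  rem-small k = DM.m<n⇒m%n≡m {{ℕₚ.m^n≢0 p k}}

  rem-rem : ∀ x k → rem (rem x (suc k)) k ≡ rem x k
  rem-rem x k =
    DM.m∣n⇒o%n%m≡o%m (p ^ k) (p ^ suc k) x
      {{ℕₚ.m^n≢0 p k}} {{ℕₚ.m^n≢0 p (suc k)}} (n∣m*n p)

  -- The inverse limit of the rings ℤ/pᵏℤ, the latter represented by the
  -- residues 0, …, pᵏ - 1; the transition maps are reduction mod pᵏ.
  record ℤₚ : Set where
    field
      residue  : ∀ k → Fin (p ^ k)
      coherent : ∀ k → reduce (toℕ (residue (suc k))) k ≡ residue k

  open ℤₚ public

  _≡_mod^_ : ℤₚ → ℤₚ → ℕ → Set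
  a ≡ b mod^ k = residue a k ≡ residue b k

  _≈_ : ℤₚ → ℤₚ → Set
  a ≈ b = ∀ k → a ≡ b mod^ k

  ℤₚ-setoid : Setoid 0ℓ 0ℓ
  ℤₚ-setoid = record
    { Carrier       = ℤₚ
    ; _≈_           = _≈_
    ; isEquivalence = record
      { refl  = λ _ → refl
      ; sym   = λ eq k → sym (eq k)
      ; trans = λ eq₁ eq₂ k → trans (eq₁ k) (eq₂ k)
      }
    }

  coherentℕ : ∀ a k → rem (toℕ (residue a (suc k))) k ≡ toℕ (residue a k)
  coherentℕ a k = trans (sym (toℕ-reduce _ k)) (cong toℕ (coherent a k))

  limit : (x : ℕ → ℕ) → (∀ k → rem (x (suc k)) k ≡ rem (x k) k) → ℤₚ
  limit x coh = record
    { residue  = λ k → reduce (x k) k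
    ; coherent = λ k → toℕ-injective (begin
        toℕ (reduce (toℕ (reduce (x (suc k)) (suc k))) k)
          ≡⟨ toℕ-reduce _ k ⟩
        rem (toℕ (reduce (x (suc k)) (suc k))) k
          ≡⟨ cong (λ y → rem y k) (toℕ-reduce _ (suc k)) ⟩
        rem (rem (x (suc k)) (suc k)) k
          ≡⟨ rem-rem (x (suc k)) k ⟩
        rem (x (suc k)) k
          ≡⟨ coh k ⟩
        rem (x k) k
          ≡⟨ toℕ-reduce _ k ⟨
        toℕ (reduce (x k) k) ∎)
    }
    where open ≡-Reasoning

  rem-idem : ∀ x k → rem (rem x k) k ≡ rem x k
  rem-idem x k = DM.m%n%n≡m%n x (p ^ k) {{ℕₚ.m^n≢0 p k}}

  residueℕ-rem : ∀ a k → rem (toℕ (residue a k)) k ≡ toℕ (residue a k)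
  residueℕ-rem a k = rem-small k (toℕ<n (residue a k))

  coherent-rem : ∀ a k → rem (toℕ (residue a (suc k))) k ≡ rem (toℕ (residue a k)) k
  coherent-rem a k = trans (coherentℕ a k) (sym (residueℕ-rem a k))

  rem-+ : ∀ x y k → rem (x ℕ.+ y) k ≡ rem (rem x k ℕ.+ rem y k) k
  rem-+ x y k = DM.%-distribˡ-+ x y (p ^ k) {{ℕₚ.m^n≢0 p k}}

  rem-* : ∀ x y k → rem (x ℕ.* y) k ≡ rem (rem x k ℕ.* rem y k) k
  rem-* x y k = DM.%-distribˡ-* x y (p ^ k) {{ℕₚ.m^n≢0 p k}}

  rem-+-cong : ∀ {x x′ y y′} k → rem x k ≡ rem x′ k → rem y k ≡ rem y′ k →
               rem (x ℕ.+ y) k ≡ rem (x′ ℕ.+ y′) k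
  rem-+-cong k e f =
    trans (rem-+ _ _ k) (trans (cong₂ (λ u v → rem (u ℕ.+ v) k) e f) (sym (rem-+ _ _ k)))

  rem-*-cong : ∀ {x x′ y y′} k → rem x k ≡ rem x′ k → rem y k ≡ rem y′ k →
               rem (x ℕ.* y) k ≡ rem (x′ ℕ.* y′) k
  rem-*-cong k e f =
    trans (rem-* _ _ k) (trans (cong₂ (λ u v → rem (u ℕ.* v) k) e f) (sym (rem-* _ _ k)))

  fromℕ : ℕ → ℤₚ
  fromℕ x = limit (λ _ → x) (λ _ → refl)

  _+_ : ℤₚ → ℤₚ → ℤₚ
  a + b = limit (λ k → toℕ (residue a k) ℕ.+ toℕ (residue b k))
    (λ k → rem-+-cong k (coherent-rem a k) (coherent-rem b k))

  _*_ : ℤₚ → ℤₚ → ℤₚ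
  a * b = limit (λ k → toℕ (residue a k) ℕ.* toℕ (residue b k))
    (λ k → rem-*-cong k (coherent-rem a k) (coherent-rem b k))

  -- a % p; the cast identifies Fin (p ^ 1) with Fin p.
  digit : ℤₚ → Fin p
  digit a = cast (ℕₚ.^-identityʳ p) (residue a 1)

  /-bound : ∀ {x} k → x < p ^ suc k → x / p < p ^ k
  /-bound {x} k x< = DM.m<n*o⇒m/o<n (subst (x <_) (ℕₚ.*-comm p (p ^ k)) x<)

  rem-suc-/ : ∀ x k → rem x (suc k) / p ≡ rem (x / p) k
  rem-suc-/ x k = trans
    (cong (λ y → y / p) (DM.%-congʳ {o = x} {{ℕₚ.m^n≢0 p (suc k)}} {{n≢0}} (ℕₚ.*-comm p (p ^ k))))
    (DM.m%[n*o]/o≡m/o%n x (p ^ k) p {{ℕₚ.m^n≢0 p k}} {{p≢0}} {{n≢0}})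
    where
    n≢0 : NonZero (p ^ k ℕ.* p)
    n≢0 = ℕₚ.m*n≢0 (p ^ k) p {{ℕₚ.m^n≢0 p k}}

  -- (a - a % p) / p: modulo pᵏ it is (x - x % p) / p = ⌊x / p⌋, where x is
  -- the residue of a modulo pᵏ⁺¹. By quot-spec and quot-unique it is the
  -- unique b with a ≈ a % p + p b.
  quot : ℤₚ → ℤₚ
  quot a = record
    { residue  = λ k → fromℕ< (/-bound k (toℕ<n (residue a (suc k))))
    ; coherent = λ k → toℕ-injective (begin
        toℕ (reduce (toℕ (fromℕ< (/-bound (suc k) (toℕ<n (residue a (suc (suc k))))))) k)
          ≡⟨ toℕ-reduce _ k ⟩
        rem (toℕ (fromℕ< (/-bound (suc k) (toℕ<n (residue a (suc (suc k))))))) k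
          ≡⟨ cong (λ y → rem y k) (toℕ-fromℕ< _) ⟩
        rem (toℕ (residue a (suc (suc k))) / p) k
          ≡⟨ rem-suc-/ _ k ⟨
        rem (toℕ (residue a (suc (suc k)))) (suc k) / p
          ≡⟨ cong (_/ p) (coherentℕ a (suc k)) ⟩
        toℕ (residue a (suc k)) / p
          ≡⟨ toℕ-fromℕ< _ ⟨
        toℕ (fromℕ< (/-bound k (toℕ<n (residue a (suc k))))) ∎)
    }
    where open ≡-Reasoning

  toℕ-quot : ∀ a k → toℕ (residue (quot a) k) ≡ toℕ (residue a (suc k)) / p
  toℕ-quot a k = toℕ-fromℕ< _

  toℕ-digit : ∀ a k → toℕ (digit a) ≡ toℕ (residue a (suc k)) % p
  toℕ-digit a k = trans (toℕ-cast _ (residue a 1)) (sym (go k))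
    where
    go : ∀ k → toℕ (residue a (suc k)) % p ≡ toℕ (residue a 1)
    go zero = DM.m<n⇒m%n≡m
      (subst (toℕ (residue a 1) <_) (ℕₚ.^-identityʳ p) (toℕ<n (residue a 1)))
    go (suc k) = begin
      toℕ (residue a (suc (suc k))) % p
        ≡⟨ DM.m∣n⇒o%n%m≡o%m p (p ^ suc k) _ {{p≢0}} {{ℕₚ.m^n≢0 p (suc k)}}
             (m∣m*n (p ^ k)) ⟨
      rem (toℕ (residue a (suc (suc k)))) (suc k) % p
        ≡⟨ cong (_% p) (coherentℕ a (suc k)) ⟩
      toℕ (residue a (suc k)) % p
        ≡⟨ go k ⟩
      toℕ (residue a 1) ∎
      where open ≡-Reasoning

  toℕ-digit+p* : ∀ d b k → toℕ (residue (fromℕ d + fromℕ p * b) k)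
                         ≡ rem (d ℕ.+ p ℕ.* toℕ (residue b k)) k
  toℕ-digit+p* d b k = trans (toℕ-reduce _ k) (rem-+-cong k (eq d) (begin
      rem (toℕ (residue (fromℕ p * b) k)) k
        ≡⟨ cong (λ y → rem y k) (toℕ-reduce _ k) ⟩
      rem (rem (toℕ (residue (fromℕ p) k) ℕ.* toℕ (residue b k)) k) k
        ≡⟨ rem-idem _ k ⟩
      rem (toℕ (residue (fromℕ p) k) ℕ.* toℕ (residue b k)) k
        ≡⟨ rem-*-cong k (eq p) refl ⟩
      rem (p ℕ.* toℕ (residue b k)) k ∎))
    where
    open ≡-Reasoning
    eq : ∀ x → rem (toℕ (residue (fromℕ x) k)) k ≡ rem x k
    eq x = trans (cong (λ y → rem y k) (toℕ-reduce x k)) (rem-idem x k)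

  quot-spec : ∀ a → a ≈ fromℕ (toℕ (digit a)) + fromℕ p * quot a
  quot-spec a k = toℕ-injective (sym (begin
    toℕ (residue (fromℕ (toℕ (digit a)) + fromℕ p * quot a) k)
      ≡⟨ toℕ-digit+p* _ (quot a) k ⟩
    rem (toℕ (digit a) ℕ.+ p ℕ.* toℕ (residue (quot a) k)) k
      ≡⟨ cong₂ (λ u v → rem (u ℕ.+ v) k) (toℕ-digit a k)
           (trans (cong (p ℕ.*_) (toℕ-quot a k)) (ℕₚ.*-comm p _)) ⟩
    rem (toℕ (residue a (suc k)) % p ℕ.+ toℕ (residue a (suc k)) / p ℕ.* p) k
      ≡⟨ cong (λ y → rem y k) (DM.m≡m%n+[m/n]*n _ p) ⟨
    rem (toℕ (residue a (suc k))) k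
      ≡⟨ coherentℕ a k ⟩
    toℕ (residue a k) ∎))
    where open ≡-Reasoning

  quot-unique : ∀ a b → a ≈ fromℕ (toℕ (digit a)) + fromℕ p * b → b ≈ quot a
  quot-unique a b a≈ k = toℕ-injective (sym (begin
    toℕ (residue (quot a) k)
      ≡⟨ toℕ-quot a k ⟩
    toℕ (residue a (suc k)) / p
      ≡⟨ cong (λ y → toℕ y / p) (a≈ (suc k)) ⟩
    toℕ (residue (fromℕ d + fromℕ p * b) (suc k)) / p
      ≡⟨ cong (_/ p) (toℕ-digit+p* d b (suc k)) ⟩
    rem (d ℕ.+ p ℕ.* b₁) (suc k) / p
      ≡⟨ rem-suc-/ _ k ⟩
    rem ((d ℕ.+ p ℕ.* b₁) / p) k
      ≡⟨ cong (λ y → rem y k) (DM.+-distrib-/-∣ʳ d (m∣m*n b₁)) ⟩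
    rem (d / p ℕ.+ p ℕ.* b₁ / p) k
      ≡⟨ cong₂ (λ u v → rem (u ℕ.+ v) k) (DM.m<n⇒m/n≡0 (toℕ<n (digit a)))
           (trans (cong (_/ p) (ℕₚ.*-comm p b₁)) (DM.m*n/n≡m b₁ p)) ⟩
    rem b₁ k
      ≡⟨ coherentℕ b k ⟩
    toℕ (residue b k) ∎))
    where
    open ≡-Reasoning
    d  = toℕ (digit a)
    b₁ = toℕ (residue b (suc k))

  -- Functions on ℤₚ are required to respect the equality _≈_.
  FibredFunction : Set
  FibredFunction = Fin p → Func ℤₚ-setoid ℤₚ-setoid

  apply : FibredFunction → ℤₚ → ℤₚ
  apply F n = quot (Func.to (F (digit n)) n)

  _∼ₚ_ : FibredFunction → FibredFunction → Set
  F ∼ₚ F′ = ∀ n → apply F n ≈ apply F′ n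

  ψ : FibredFunction → ℤₚ → ℕ → Fin p
  ψ F n k = digit (iterate (apply F) n k)

  record PAdicSystem : Set where
    field
      fibred : FibredFunction
      ψ-adic : ∀ k m n →
        m ≡ n mod^ k ⇔ (∀ i → i < k → ψ fibred m i ≡ ψ fibred n i)

  open PAdicSystem public

  private
    module _ (F : PAdicSystem) where

      ψ-determines : ∀ k m n → (∀ i → i < k → ψ (fibred F) m i ≡ ψ (fibred F) n i) →
                     m ≡ n mod^ k
      ψ-determines k m n = Equivalence.from (ψ-adic F k m n)

      determines-ψ : ∀ k m n → m ≡ n mod^ k →
                     ∀ i → i < k → ψ (fibred F) m i ≡ ψ (fibred F) n i
      determines-ψ k m n = Equivalence.to (ψ-adic F k m n)

      prefix : (ℕ → Fin p) → ∀ k → Fin k → Fin p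
      prefix s k i = s (toℕ i)

      prefix-≡ : ∀ s t k → funToFin (prefix s k) ≡ funToFin (prefix t k) →
                 ∀ i → i < k → s i ≡ t i
      prefix-≡ s t k eq i i<k = begin
        s i                                    ≡⟨ cong s (toℕ-fromℕ< i<k) ⟨
        prefix s k j                           ≡⟨ finToFun-funToFin (prefix s k) j ⟨
        finToFun (funToFin (prefix s k)) j     ≡⟨ cong (λ f → finToFun f j) eq ⟩
        finToFun (funToFin (prefix t k)) j     ≡⟨ finToFun-funToFin (prefix t k) j ⟩
        prefix t k j                           ≡⟨ cong t (toℕ-fromℕ< i<k) ⟩
        t i                                    ∎
        where
        open ≡-Reasoning
        j = fromℕ< i<k

      residue-fromℕ : ∀ k (x : Fin (p ^ k)) → residue (fromℕ (toℕ x)) k ≡ x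
      residue-fromℕ k x =
        toℕ-injective (trans (toℕ-reduce _ k) (rem-small k (toℕ<n x)))

      prefixOf : ∀ k → Fin (p ^ k) → Fin (p ^ k)
      prefixOf k x = funToFin (prefix (ψ (fibred F) (fromℕ (toℕ x))) k)

      prefixOf-injective : ∀ k → Injective _≡_ _≡_ (prefixOf k)
      prefixOf-injective k {x} {y} eq = begin
        x                            ≡⟨ residue-fromℕ k x ⟨
        residue (fromℕ (toℕ x)) k    ≡⟨ ψ-determines k _ _ (prefix-≡ _ _ k eq) ⟩
        residue (fromℕ (toℕ y)) k    ≡⟨ residue-fromℕ k y ⟩
        y                            ∎
        where open ≡-Reasoning

      module _ (s : ℕ → Fin p) where

        approx : ∀ k → ∃ λ x → prefixOf k x ≡ funToFin (prefix s k)
        approx k = Fin-injective⇒surjective (prefixOf k) (prefixOf-injective k) _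

        x : ∀ k → Fin (p ^ k)
        x k = proj₁ (approx k)

        ψ-x : ∀ k i → i < k → ψ (fibred F) (fromℕ (toℕ (x k))) i ≡ s i
        ψ-x k = prefix-≡ _ s k (proj₂ (approx k))

        ψ-preimage : ℤₚ
        ψ-preimage = record
          { residue  = x
          ; coherent = λ k → trans
              (ψ-determines k (fromℕ (toℕ (x (suc k)))) (fromℕ (toℕ (x k)))
                (λ i i<k → trans (ψ-x (suc k) i (ℕₚ.m<n⇒m<1+n i<k)) (sym (ψ-x k i i<k))))
              (residue-fromℕ k (x k))
          }

        ψ-ψ-preimage : ∀ i → ψ (fibred F) ψ-preimage i ≡ s i
        ψ-ψ-preimage i = trans
          (determines-ψ (suc i) ψ-preimage (fromℕ (toℕ (x (suc i))))
            (sym (residue-fromℕ (suc i) (x (suc i)))) i ℕₚ.≤-refl)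
          (ψ-x (suc i) i ℕₚ.≤-refl)

  ψ-bijection : PAdicSystem → Bijection ℤₚ-setoid (ℕ →-setoid Fin p)
  ψ-bijection F = record
    { to        = ψ (fibred F)
    ; cong      = ψ-cong
    ; bijective =
        (λ {m} {n} eq k → ψ-determines F k m n (λ i _ → eq i)) ,
        (λ s → ψ-preimage F s ,
          λ {n} n≈ i → trans (ψ-cong {n} {ψ-preimage F s} n≈ i) (ψ-ψ-preimage F s i))
    }
    where
    ψ-cong : ∀ {m n} → m ≈ n → ∀ i → ψ (fibred F) m i ≡ ψ (fibred F) n i
    ψ-cong {m} {n} eq i = determines-ψ F (suc i) m n (eq (suc i)) i ℕₚ.≤-refl

  ψ⁻¹ : PAdicSystem → (ℕ → Fin p) → ℤₚ
  ψ⁻¹ F = Bijection.to⁻ (ψ-bijection F)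

  π[_,_] : PAdicSystem → PAdicSystem → ℤₚ → ℤₚ
  π[ F , G ] = ψ⁻¹ G ∘ ψ (fibred F)

  record IsPAdicPermutation (π : ℤₚ → ℤₚ) : Set where
    field
      isBijection : IsBijection _≈_ _≈_ π
      fixes-mod-p : ∀ n → π n ≡ n mod^ 1
      adic        : ∀ k → 1 ℕ.≤ k → ∀ m n → m ≡ n mod^ k ⇔ π m ≡ π n mod^ k

{-# OPTIONS --safe #-}

-- F is the conjugate of G by π: take F[r](n) = p · π⁻¹(G(π(n))) for every r,
-- so that F(n) = π⁻¹(G(π(n))). As π preserves the residue mod p, it carries the
-- F-orbit of n to the G-orbit of π(n) without changing digits: ψ_F = ψ_G ∘ π.
-- Conversely π = π_{F,G} forces ψ_F = ψ_G ∘ π, and ψ_F determines F since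
-- ψ_F(F(n)) is the shift of ψ_F(n).

module Submission where

open import Data.Nat.Base using (ℕ; zero; suc; NonTrivial; NonZero; _^_; _%_; z≤n; s≤s;
         nonTrivial⇒nonZero)
import Data.Nat.Base as ℕ
import Data.Nat.DivMod as DM
import Data.Nat.Properties as ℕₚ
open import Data.Nat.Divisibility using (n∣m⇒m%n≡0; m∣m*n)
open import Data.Fin.Base using (Fin; toℕ; cast)
open import Data.Fin.Properties using (toℕ-injective)
open import Data.Product using (∃!; _,_; proj₁; proj₂)
open import Function.Base using (_on_; _∘_)
open import Function.Bundles using (Func; Bijection; _⇔_; mk⇔; module Equivalence)
open import Function.Structures using (IsBijection)
open import Relation.Binary.Bundles using (Setoid)
open import Relation.Binary.PropositionalEquality
  using (_≡_; refl; sym; trans; cong; subst; module ≡-Reasoning)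
open import Defs

module _ (p : ℕ) .{{p>1 : NonTrivial p}} where

  open PAdic p

  private
    instance
      p≢0 : NonZero p
      p≢0 = nonTrivial⇒nonZero p

  ≈-refl : ∀ a → a ≈ a
  ≈-refl a = Setoid.refl ℤₚ-setoid {a}

  ≈-sym : ∀ {a b} → a ≈ b → b ≈ a
  ≈-sym {a} {b} = Setoid.sym ℤₚ-setoid {a} {b}

  ≈-trans : ∀ {a b c} → a ≈ b → b ≈ c → a ≈ c
  ≈-trans {a} {b} {c} = Setoid.trans ℤₚ-setoid {a} {b} {c}

  digit-cong₁ : ∀ a b → a ≡ b mod^ 1 → digit a ≡ digit b
  digit-cong₁ _ _ = cong (cast (ℕₚ.^-identityʳ p))

  quot-cong : ∀ {a b} → a ≈ b → quot a ≈ quot b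
  quot-cong {a} {b} a≈b k = toℕ-injective (begin
    toℕ (residue (quot a) k)        ≡⟨ toℕ-quot a k ⟩
    toℕ (residue a (suc k)) ℕ./ p   ≡⟨ cong (λ r → toℕ r ℕ./ p) (a≈b (suc k)) ⟩
    toℕ (residue b (suc k)) ℕ./ p   ≡⟨ toℕ-quot b k ⟨
    toℕ (residue (quot b) k)        ∎)
    where open ≡-Reasoning

  -- The summand `fromℕ 0` is the zero digit: it gives multiplication by p the shape digit + p ·
  -- quotient in which `quot-unique` recognises the quotient.
  p* : ℤₚ → ℤₚ
  p* b = fromℕ 0 + fromℕ p * b

  p*-cong : ∀ {a b} → a ≈ b → p* a ≈ p* b
  p*-cong {a} {b} a≈b k = toℕ-injective (begin
    toℕ (residue (p* a) k)                 ≡⟨ toℕ-digit+p* 0 a k ⟩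
    rem (p ℕ.* toℕ (residue a k)) k        ≡⟨ cong (λ r → rem (p ℕ.* toℕ r) k) (a≈b k) ⟩
    rem (p ℕ.* toℕ (residue b k)) k        ≡⟨ toℕ-digit+p* 0 b k ⟨
    toℕ (residue (p* b) k)                 ∎)
    where open ≡-Reasoning

  digit-p* : ∀ b → toℕ (digit (p* b)) ≡ 0
  digit-p* b = begin
    toℕ (digit (p* b))                     ≡⟨ toℕ-digit (p* b) 0 ⟩
    toℕ (residue (p* b) 1) % p             ≡⟨ cong (_% p) (toℕ-digit+p* 0 b 1) ⟩
    rem (p ℕ.* toℕ (residue b 1)) 1 % p    ≡⟨ DM.m∣n⇒o%n%m≡o%m p (p ^ 1) _ {{p≢0}} {{ℕₚ.m^n≢0 p 1}} (m∣m*n 1) ⟩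
    p ℕ.* toℕ (residue b 1) % p            ≡⟨ n∣m⇒m%n≡0 _ p (m∣m*n (toℕ (residue b 1))) ⟩
    0                                      ∎
    where open ≡-Reasoning

  -- Makes `p*` a right inverse of `quot`, so that any map respecting `≈` can be realised as `apply`
  -- of a fibred function.
  quot-p* : ∀ b → quot (p* b) ≈ b
  quot-p* b = ≈-sym {b} {quot (p* b)} (quot-unique (p* b) b
    (subst (λ d → p* b ≈ fromℕ d + fromℕ p * b) (sym (digit-p* b)) (≈-refl (p* b))))

  -- Equal arguments have equal last digits, so both sides use the same component of `F`; the
  -- `subst` identifies the two indices.
  apply-cong : ∀ (F : FibredFunction) {m n} → m ≈ n → apply F m ≈ apply F n
  apply-cong F {m} {n} m≈n = quot-cong {Func.to (F (digit m)) m} {Func.to (F (digit n)) n}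
    (subst (λ d → Func.to (F (digit m)) m ≈ Func.to (F d) n) (digit-cong₁ m n (m≈n 1))
      (Func.cong (F (digit m)) {m} {n} m≈n))

  ψ-injective : ∀ (F : PAdicSystem) {m n} → (∀ i → ψ (fibred F) m i ≡ ψ (fibred F) n i) → m ≈ n
  ψ-injective F {m} {n} = Bijection.injective (ψ-bijection F) {m} {n}

  ψ-ψ⁻¹ : ∀ (F : PAdicSystem) s i → ψ (fibred F) (ψ⁻¹ F s) i ≡ s i
  ψ-ψ⁻¹ F s = proj₂ (Bijection.strictlySurjective (ψ-bijection F) s)

  ψ-determines-fibred : ∀ (F F′ : PAdicSystem) → (∀ n i → ψ (fibred F) n i ≡ ψ (fibred F′) n i) →
                        fibred F ∼ₚ fibred F′
  ψ-determines-fibred F F′ eq n = ψ-injective F {apply (fibred F) n} {apply (fibred F′) n}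
    -- By definition of `iterate`, entry `suc i` of the expansion of `n` is entry `i` of the
    -- expansion of its image, so the hypothesis at `n` compares the images under both systems.
    (λ i → trans (eq n (suc i)) (sym (eq (apply (fibred F′) n) i)))

  -- Congruence modulo each power of p passes through π in both directions, so the defining
  -- equivalence for `G` at `π m`, `π n` becomes the one for `F` at `m`, `n`.
  ψ≡ψ∘π⇒PAdicSystem : (π : ℤₚ → ℤₚ) → IsPAdicPermutation π →
    (F : FibredFunction) (G : PAdicSystem) →
    (∀ (n : ℤₚ) i → ψ F n i ≡ ψ (fibred G) (π n) i) → PAdicSystem
  ψ≡ψ∘π⇒PAdicSystem π π-perm F G ψ≡ψπ = record
    { fibred = F
    ; ψ-adic = λ k m n → mk⇔
        (λ m≡n i i<k → trans (ψ≡ψπ m i) (trans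
          (Equivalence.to (ψ-adic G k (π m) (π n)) (to k m n m≡n) i i<k)
          (sym (ψ≡ψπ n i))))
        (λ eq → from k m n (Equivalence.from (ψ-adic G k (π m) (π n))
          (λ i i<k → trans (sym (ψ≡ψπ m i)) (trans (eq i i<k) (ψ≡ψπ n i)))))
    }
    where
    open IsPAdicPermutation π-perm
    -- Covers k = 0, where `adic` says nothing: residues modulo 1 lie in a one-element type.
    mod^0 : ∀ a b → a ≡ b mod^ 0
    mod^0 a b with residue a 0 | residue b 0
    ... | Fin.zero | Fin.zero = refl
    to : ∀ k m n → m ≡ n mod^ k → π m ≡ π n mod^ k
    to zero    m n _ = mod^0 (π m) (π n)
    to (suc k) m n   = Equivalence.to (adic (suc k) (s≤s z≤n) m n)
    from : ∀ k m n → π m ≡ π n mod^ k → m ≡ n mod^ k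
    from zero    m n _ = mod^0 m n
    from (suc k) m n   = Equivalence.from (adic (suc k) (s≤s z≤n) m n)

  -- Applying the bijection ψ of `G` to both sides removes its inverse, leaving an equation between
  -- digits that serves for existence and for uniqueness.
  π≈π[F,G]⇔ψ≡ψ∘π : (π : ℤₚ → ℤₚ) (F G : PAdicSystem) →
    (∀ n → π n ≈ π[ F , G ] n) ⇔ (∀ n i → ψ (fibred F) n i ≡ ψ (fibred G) (π n) i)
  π≈π[F,G]⇔ψ≡ψ∘π π F G = mk⇔
    (λ eq n i → trans
      (sym (ψ-ψ⁻¹ G (ψ (fibred F) n) i))
      (sym (Bijection.cong (ψ-bijection G) {π n} {π[ F , G ] n} (eq n) i)))
    (λ eq n → ψ-injective G {π n} {π[ F , G ] n}
      (λ i → trans (sym (eq n i)) (sym (ψ-ψ⁻¹ G (ψ (fibred F) n) i))))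

  module Conjugate {π : ℤₚ → ℤₚ} (π-perm : IsPAdicPermutation π) (G : FibredFunction) where

    open IsPAdicPermutation π-perm
    open IsBijection isBijection renaming (cong to π-cong; injective to π-injective)

    π⁻¹ : ℤₚ → ℤₚ
    π⁻¹ n = proj₁ (surjective n)

    π-π⁻¹ : ∀ n → π (π⁻¹ n) ≈ n
    π-π⁻¹ n = proj₂ (surjective n) {π⁻¹ n} (≈-refl (π⁻¹ n))

    -- Surjectivity only chooses preimages; that the choice respects `≈` follows from injectivity of
    -- π.
    π⁻¹-cong : ∀ {m n} → m ≈ n → π⁻¹ m ≈ π⁻¹ n
    π⁻¹-cong {m} {n} m≈n = π-injective {π⁻¹ m} {π⁻¹ n}
      (≈-trans {π (π⁻¹ m)} {m} {π (π⁻¹ n)} (π-π⁻¹ m)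
        (≈-trans {m} {n} {π (π⁻¹ n)} m≈n (≈-sym {π (π⁻¹ n)} {n} (π-π⁻¹ n))))

    conjugate : ℤₚ → ℤₚ
    conjugate = π⁻¹ ∘ apply G ∘ π

    fibredConjugate : FibredFunction
    fibredConjugate _ = record
      { to   = p* ∘ conjugate
      ; cong = λ {m} {n} m≈n → p*-cong {conjugate m} {conjugate n}
          (π⁻¹-cong {apply G (π m)} {apply G (π n)}
            (apply-cong G {π m} {π n} (π-cong {m} {n} m≈n)))
      }

    π-intertwines : ∀ n → π (apply fibredConjugate n) ≈ apply G (π n)
    π-intertwines n = ≈-trans {π (apply fibredConjugate n)} {π (conjugate n)} {apply G (π n)}
      (π-cong {apply fibredConjugate n} {conjugate n} (quot-p* (conjugate n)))
      (π-π⁻¹ (apply G (π n)))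

    -- A general `m` in place of `π n` is needed for the induction, since `π-intertwines` matches
    -- the two orbits only up to `≈`.
    ψ-conjugate-≈ : ∀ i {n m} → π n ≈ m → ψ fibredConjugate n i ≡ ψ G m i
    ψ-conjugate-≈ zero    {n} {m} πn≈m = digit-cong₁ n m (trans (sym (fixes-mod-p n)) (πn≈m 1))
    ψ-conjugate-≈ (suc i) {n} {m} πn≈m = ψ-conjugate-≈ i {apply fibredConjugate n} {apply G m}
      (≈-trans {π (apply fibredConjugate n)} {apply G (π n)} {apply G m}
        (π-intertwines n) (apply-cong G {π n} {m} πn≈m))

    ψ-conjugate : ∀ n i → ψ fibredConjugate n i ≡ ψ G (π n) i
    ψ-conjugate n i = ψ-conjugate-≈ i {n} {π n} (≈-refl (π n))

theorem3p18 : (p : ℕ) .{{_ : NonTrivial p}} →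
    let open PAdic p in
    (π : ℤₚ → ℤₚ) → IsPAdicPermutation π →
    (G : PAdicSystem) →
    ∃! (_∼ₚ_ on fibred) (λ F → ∀ n → π n ≈ π[ F , G ] n)
theorem3p18 p π π-perm G =
  F ,
  Equivalence.from (π≈π[F,G]⇔ψ≡ψ∘π p π F G) ψ-conjugate ,
  -- Both systems have the expansion of `π n` under `G` as their expansion of `n`.
  λ {F′} eq → ψ-determines-fibred p F F′
    (λ n i → trans (ψ-conjugate n i) (sym (Equivalence.to (π≈π[F,G]⇔ψ≡ψ∘π p π F′ G) eq n i)))
  where
  open PAdic p
  open Conjugate p π-perm (fibred G)
  F = ψ≡ψ∘π⇒PAdicSystem p π π-perm fibredConjugate G ψ-conjugate
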